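{- On HDAs over $\Sigma$, ureST-bisimilarity is strictly contained in reST-bisimilarity: ${\underline{\leftrightarrow}_{ureST}}\subsetneq{\underline{\leftrightarrow}_{reST}}$.
   Context: HDAs. $\Sigma$ is a fixed set of actions, containing pairwise distinct actions $a,b,c,d$. A conclist is $U=(n,\lambda)$ with $n\in\mathbb N$ and $\lambda:\{1<\dots<n\}\to\Sigma$. The category $\square$ has conclists as objects; a morphism $(m,\lambda)\to(n,\mu)$ is a pair $(f,\varepsilon)$ with $f:\{1,\dots,m\}\to\{1,\dots,n\}$ injective, order- and label-preserving, and $\varepsilon:\{1,\dots,n\}\to\{0,*,1\}$ with $\varepsilon^{ -1}(*)=\mathrm{im} f$; composition is $(g,\zeta)\circ(f,\varepsilon)=(g\circ f,\eta)$ with $\eta(g(t))=\varepsilon(t)$ and $\eta(u)=\zeta(u)$ for $u\notin\mathrm{im}\,g$. For $1\le i\le n$, $k\in\{0,1\}$, the coface map $d_i^k:U\to V$ ($V$ of dimension $n$, $U$ of dimension $n-1$) has $f$ omitting position $i$, $\varepsilon(i)=k$, and $\varepsilon(j)=*$ for $j\ne i$. A precubical set is a functor $X:\square^{op}\to\mathbf{Set}$; elements of $X[U]$, $U=(n,\lambda)$, are $n$-dimensional cells, and $\delta_i^k:=X[d_i^k]$. An HDA is a pair $(X,i)$ of a precubical set and an initial $0$-dimensional cell $i$. Paths. A path of an HDA $\mathcal X$ is a sequence $\alpha=(x_0,\varphi_1,x_1,\dots,\varphi_n,x_n)$ ($n\ge 0$) with $x_0$ the initial cell, $x_j\in X[U_j]$,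 where for each $j$ either $\varphi_j=d^0_{i_j}:U_{j-1}\to U_j$ with $x_{j-1}=\delta^0_{i_j}(x_j)$ (up-step, starting an event) or $\varphi_j=d^1_{i_j}:U_j\to U_{j-1}$ with $x_j=\delta^1_{i_j}(x_{j-1})$ (down-step, ending an event). $\alpha\hookrightarrow\alpha'$ means $\alpha$ is a prefix of $\alpha'$. $\alpha\leftrightarrows^\ell\beta$ ($\ell$-similarity): one of $\alpha,\beta$ is obtained from the other by replacing, around the cell $x_\ell$, $(d_i^0,x_\ell,d_j^0)$ by $(d_{j-1}^0,x'_\ell,d_i^0)$, or $(d_j^1,x_\ell,d_i^1)$ by $(d_i^1,x'_\ell,d_{j-1}^1)$, for some $i<j$ and some cell $x'_\ell$. $\alpha\sqsubseteq^\ell\beta$ ($\beta$ subsumes $\alpha$ at $\ell$): $\alpha$ is obtained from $\beta$ by replacing, around $x_\ell$, $(d_i^0,x_\ell,d_j^1)$ by $(d_{j-1}^1,x'_\ell,d_i^0)$, or $(d_j^0,x_\ell,d_i^1)$ by $(d_i^1,x'_\ell,d_{j-1}^0)$, for some $i<j$. ST-traces. Given a down-step at position $p$ of a path, move it to the left: as long as the step directly before it is a down-step, or an up-step whose index differs from the current index of the moving down-step, there is a unique replacement moving it one position left: for some $i<j$ and cells $x,x'$, it replaces $(d_j^1,x,d_i^1)$ by $(d_i^1,x',d_{j-1}^1)$ or conversely (if the step directly before is a down-step), or it replaces $(d_i^0,x,d_j^1)$ by $(d_{j-1}^1,x',d_i^0)$ or $(d_j^0,x,d_i^1)$ by $(d_i^1,x',d_{j-1}^0)$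 (if the step directly before is an up-step). This stops when the step directly before it, at position $k$, is an up-step with the same index; put $\mathrm{start}(p)=k$. $\mathsf{ST}(\alpha)$ is the sequence whose $j$-th entry is $a^+$ if $\varphi_j$ is an up-step starting an event labelled $a$ (the label of the $i_j$-th event of $U_j$), and $a^{\mathrm{start}(j)}$ if $\varphi_j$ is a down-step ending an event labelled $a$ (the label of the $i_j$-th event of $U_{j-1}$). $I$-bisimulations. For $I\subseteq\{\sqsubseteq,\sqsupseteq,\leftrightarrows,\hookleftarrow\}$, an $I$-bisimulation between HDAs $\mathcal Y,\mathcal Z$ is a relation $\mathfrak R$ between paths of $\mathcal Y$ and of $\mathcal Z$ satisfying the following clauses, each also with the roles of $\mathcal Y$ and $\mathcal Z$ exchanged: (1) the length-$0$ paths of $\mathcal Y$ and $\mathcal Z$ are related; (2) if $(\alpha,\beta)\in\mathfrak R$ then $\mathsf{ST}(\alpha)=\mathsf{ST}(\beta)$; (3) if $(\alpha,\beta)\in\mathfrak R$ and $\alpha\hookrightarrow\alpha'$, there is $\beta'$ with $\beta\hookrightarrow\beta'$ and $(\alpha',\beta')\in\mathfrak R$; and those of the following whose symbol lies in $I$: ($\sqsubseteq$) if $(\alpha,\beta)\in\mathfrak R$ and $\alpha\sqsubseteq^\ell\alpha'$, there is $\beta'$ with $\beta\sqsubseteq^\ell\beta'$, $(\alpha',\beta')\in\mathfrak R$; ($\sqsupseteq$) the same with $\alpha'\sqsubseteq^\ell\alpha$ and $\beta'\sqsubseteq^\ell\beta$; ($\leftrightarrows$) the same with $\alpha'\leftrightarrows^\ell\alpha$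 and $\beta'\leftrightarrows^\ell\beta$; ($\hookleftarrow$) the same with $\alpha'\hookrightarrow\alpha$ and $\beta'\hookrightarrow\beta$. $\mathcal Y,\mathcal Z$ are $I$-bisimilar, $\mathcal Y\,\underline{\leftrightarrow}_I\,\mathcal Z$, if an $I$-bisimulation between them exists. Names: reST is $I=\{\leftrightarrows,\hookleftarrow\}$; ureST is $I=\{\sqsupseteq,\leftrightarrows,\hookleftarrow\}$. -}

module Defs where

open import Level using (0ℓ)
open import Data.Nat as ℕ using (ℕ; zero; suc)
open import Data.Fin using (Fin; zero; suc; toℕ; punchIn; punchOut; _≤_)
open import Data.Fin.Properties
  using (_≟_; any?; punchIn-injective; punchIn-mono-≤; punchInᵢ≢i; punchIn-punchOut)
open import Data.Vec using (Vec; []; _∷_; lookup; removeAt)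
open import Data.List as List using (List; _∷ʳ_)
open import Data.Product using (∃; ∃-syntax; _×_; _,_; proj₁; proj₂)
open import Data.Sum using (_⊎_; inj₁; inj₂) renaming (map to map-⊎)
open import Function using (_∘_; id; flip; _⇔_; mk⇔; Equivalence; Injective)
open import Relation.Binary using (_Preserves_⟶_; Rel; REL)
open import Relation.Binary.PropositionalEquality
open import Relation.Nullary using (yes; no; contradiction)
open import Relation.Unary using (Pred; _∈_; _∪_; ｛_｝)

private variable
  Act : Set

------------------------------------------------------------------------
-- The category □.  Positions 1 < … < n are the elements of Fin n, so all
-- indices are shifted by one with respect to the usual 1-based notation.

Conclist : Set → Set
Conclist Act = ∃ (Vec Act)

dim : Conclist Act → ℕ
dim = proj₁

data Sign : Set where
  𝟎 𝟏 : Sign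

data Value : Set where
  ✶    : Value
  sign : Sign → Value

record Hom (U V : Conclist Act) : Set where
  field
    f         : Fin (dim U) → Fin (dim V)
    ε         : Fin (dim V) → Value
    injective : Injective _≡_ _≡_ f
    monotone  : f Preserves _≤_ ⟶ _≤_
    labels    : ∀ t → lookup (proj₂ V) (f t) ≡ lookup (proj₂ U) t
    image     : ∀ u → ε u ≡ ✶ ⇔ (∃[ t ] f t ≡ u)

-- Equality of morphisms as pairs of functions.
_≈_ : {U V : Conclist Act} → Rel (Hom U V) 0ℓ
g ≈ h = (∀ t → Hom.f g t ≡ Hom.f h t) × (∀ u → Hom.ε g u ≡ Hom.ε h u)

idHom : (U : Conclist Act) → Hom U U
idHom U = record
  { f         = id
  ; ε         = λ _ → ✶
  ; injective = id
  ; monotone  = id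
  ; labels    = λ _ → refl
  ; image     = λ u → mk⇔ (λ _ → u , refl) (λ _ → refl)
  }

module _ {U V W : Conclist Act} (h : Hom V W) (k : Hom U V) where
  private
    module h = Hom h
    module k = Hom k

  compε : Fin (dim W) → Value
  compε u with any? (λ t → h.f t ≟ u)
  ... | yes (t , _) = k.ε t
  ... | no  _       = h.ε u

  private
    comp-image : ∀ u → compε u ≡ ✶ ⇔ (∃[ t ] h.f (k.f t) ≡ u)
    comp-image u with any? (λ t → h.f t ≟ u)
    ... | yes (t , refl) = mk⇔
      (λ eq → let s , ks≡t = Equivalence.to (k.image t) eq in s , cong h.f ks≡t)
      (λ (s , eq) → Equivalence.from (k.image t) (s , h.injective eq))
    ... | no t∄ = mk⇔
      (λ eq → contradiction (Equivalence.to (h.image u) eq) t∄)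
      (λ (s , eq) → contradiction (k.f s , eq) t∄)

  compHom : Hom U W
  compHom = record
    { f         = h.f ∘ k.f
    ; ε         = compε
    ; injective = k.injective ∘ h.injective
    ; monotone  = h.monotone ∘ k.monotone
    ; labels    = λ t → trans (h.labels (k.f t)) (k.labels t)
    ; image     = comp-image
    }

cofaceε : ∀ {n} → Sign → Fin (suc n) → Fin (suc n) → Value
cofaceε k i j with i ≟ j
... | yes _ = sign k
... | no  _ = ✶

lookup-punchIn : ∀ {n} (V : Vec Act (suc n)) i t →
                 lookup V (punchIn i t) ≡ lookup (removeAt V i) t
lookup-punchIn (x ∷ V)     zero    t       = refl
lookup-punchIn (x ∷ _ ∷ _) (suc i) zero    = refl
lookup-punchIn (x ∷ y ∷ V) (suc i) (suc t) = lookup-punchIn (y ∷ V) i t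

coface : ∀ {n} (k : Sign) {V : Vec Act (suc n)} (i : Fin (suc n)) →
         Hom (n , removeAt V i) (suc n , V)
coface k {V} i = record
  { f         = punchIn i
  ; ε         = cofaceε k i
  ; injective = λ {s} {t} → punchIn-injective i s t
  ; monotone  = λ {s} {t} → punchIn-mono-≤ i s t
  ; labels    = lookup-punchIn V i
  ; image     = cofaceε-image
  }
  where
  cofaceε-image : ∀ u → cofaceε k i u ≡ ✶ ⇔ (∃[ t ] punchIn i t ≡ u)
  cofaceε-image u with i ≟ u
  ... | yes refl = mk⇔ (λ ()) (λ (t , eq) → contradiction eq (punchInᵢ≢i i t))
  ... | no  i≢u  = mk⇔ (λ _ → punchOut i≢u , punchIn-punchOut i≢u) (λ _ → refl)

------------------------------------------------------------------------
-- Precubical sets and HDAs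

record PrecubicalSet (Act : Set) : Set₁ where
  field
    _[_]   : Conclist Act → Set
    map    : ∀ {U V} → Hom U V → _[_] V → _[_] U
    map-≈  : ∀ {U V} {g h : Hom U V} → g ≈ h → ∀ x → map g x ≡ map h x
    map-id : ∀ {U} x → map (idHom U) x ≡ x
    map-∘  : ∀ {U V W} (h : Hom V W) (k : Hom U V) x →
             map (compHom h k) x ≡ map k (map h x)

  Cell : Set
  Cell = ∃ _[_]

  δ : ∀ {n} (k : Sign) {V : Vec Act (suc n)} (i : Fin (suc n)) →
      _[_] (suc n , V) → _[_] (n , removeAt V i)
  δ k i = map (coface k i)

record HDA (Act : Set) : Set₁ where
  field
    precubicalSet : PrecubicalSet Act
  open PrecubicalSet precubicalSet public
  field
    init : _[_] (0 , [])

cellDim : (X : HDA Act) → HDA.Cell X → ℕ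
cellDim _ ((n , _) , _) = n

------------------------------------------------------------------------
-- Paths

module _ (X : HDA Act) where
  open HDA X

  -- `up i` is d⁰ᵢ : U → V and `down i` is d¹ᵢ : V → U; since d⁰ᵢ and d¹ᵢ are
  -- determined by V and i, recording the index i amounts to recording φⱼ.
  data Step : Rel Cell 0ℓ where
    up   : ∀ {n} {V : Vec Act (suc n)} {x : _[_] (suc n , V)} {y : Cell}
           (i : Fin (suc n)) → y ≡ (_ , δ 𝟎 i x) → Step y (_ , x)
    down : ∀ {n} {V : Vec Act (suc n)} {x : _[_] (suc n , V)} {y : Cell}
           (i : Fin (suc n)) → y ≡ (_ , δ 𝟏 i x) → Step (_ , x) y

  infixl 5 _▸_

  data PathTo : Cell → Set where
    []  : PathTo (_ , init)
    _▸_ : ∀ {x y} → PathTo x → Step x y → PathTo y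

  Path : Set
  Path = ∃ PathTo

module _ {X : HDA Act} where
  open HDA X

  emptyPath : Path X
  emptyPath = _ , []

  length : ∀ {x} → PathTo X x → ℕ
  length []      = 0
  length (α ▸ _) = suc (length α)

  data _↪_ : Rel (Path X) 0ℓ where
    ↪-refl : ∀ {α} → α ↪ α
    ↪-step : ∀ {α x y} {β : PathTo X x} {φ : Step X x y} →
             α ↪ (x , β) → α ↪ (y , β ▸ φ)

-- `d k i` is the symbol dᵏᵢ occurring in a path.
data Symbol : Set where
  d : Sign → ℕ → Symbol

symbol : ∀ {X : HDA Act} {x y} → Step X x y → Symbol
symbol (up   i _) = d 𝟎 (toℕ i)
symbol (down i _) = d 𝟏 (toℕ i)

-- `T s t s′ t′` reads: (s , x , t) may be replaced by (s′ , x′ , t′).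
Replacement : Set₁
Replacement = (s t s′ t′ : Symbol) → Set

-- In both rules i < j is written as i < suc j with i ≤ j, so that the index
-- "j - 1" is j.
data Swap : Replacement where
  swap⁰⁰ : ∀ {i j} → i ℕ.≤ j → Swap (d 𝟎 i) (d 𝟎 (suc j)) (d 𝟎 j) (d 𝟎 i)
  swap¹¹ : ∀ {i j} → i ℕ.≤ j → Swap (d 𝟏 (suc j)) (d 𝟏 i) (d 𝟏 i) (d 𝟏 j)

data Serialise : Replacement where
  serial< : ∀ {i j} → i ℕ.≤ j → Serialise (d 𝟎 i) (d 𝟏 (suc j)) (d 𝟏 j) (d 𝟎 i)
  serial> : ∀ {i j} → i ℕ.≤ j → Serialise (d 𝟎 (suc j)) (d 𝟏 i) (d 𝟏 i) (d 𝟎 j)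

module _ {X : HDA Act} where

  -- The second path is obtained from the first by a replacement around x_ℓ.
  data Replace (T : Replacement) : ℕ → Rel (Path X) 0ℓ where
    here  : ∀ {x y y′ z} {α : PathTo X x}
            {φ : Step X x y} {ψ : Step X y z} {φ′ : Step X x y′} {ψ′ : Step X y′ z} →
            T (symbol φ) (symbol ψ) (symbol φ′) (symbol ψ′) →
            Replace T (suc (length α)) (z , α ▸ φ ▸ ψ) (z , α ▸ φ′ ▸ ψ′)
    there : ∀ {ℓ x y} {α β : PathTo X x} {φ : Step X x y} →
            Replace T ℓ (x , α) (x , β) → Replace T ℓ (y , α ▸ φ) (y , β ▸ φ)

  _⇆⟨_⟩_ : Path X → ℕ → Path X → Set
  α ⇆⟨ ℓ ⟩ β = Replace Swap ℓ α β ⊎ Replace Swap ℓ β α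

  _⊑⟨_⟩_ : Path X → ℕ → Path X → Set
  α ⊑⟨ ℓ ⟩ β = Replace Serialise ℓ β α

------------------------------------------------------------------------
-- ST-traces

-- How a down-step d¹ⱼ changes its index when moved to the left of a step with
-- index i: over an up-step it becomes d¹ of punchOut, over a down-step d¹ of
-- punchIn.

move-over-up : ∀ {n} {i j : Fin (suc n)} (i≢j : i ≢ j) → ∃[ k ]
  Serialise (d 𝟎 (toℕ i)) (d 𝟏 (toℕ j)) (d 𝟏 (toℕ (punchOut i≢j))) (d 𝟎 k)
move-over-up {i = zero}  {zero}  i≢j = contradiction refl i≢j
move-over-up {i = zero}  {suc j} i≢j = 0 , serial< ℕ.z≤n
move-over-up {suc _} {suc i} {zero}  i≢j = toℕ i , serial> ℕ.z≤n
move-over-up {suc _} {suc i} {suc j} i≢j with move-over-up (i≢j ∘ cong suc)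
... | k , r = suc k , shift r
  where
  shift : ∀ {i j j′ k} → Serialise (d 𝟎 i) (d 𝟏 j) (d 𝟏 j′) (d 𝟎 k) →
          Serialise (d 𝟎 (suc i)) (d 𝟏 (suc j)) (d 𝟏 (suc j′)) (d 𝟎 (suc k))
  shift (serial< i≤j) = serial< (ℕ.s≤s i≤j)
  shift (serial> i≤j) = serial> (ℕ.s≤s i≤j)

move-over-down : ∀ {n} (i : Fin (suc n)) (j : Fin n) → ∃[ k ]
    (Swap (d 𝟏 (toℕ i)) (d 𝟏 (toℕ j)) (d 𝟏 (toℕ (punchIn i j))) (d 𝟏 k)
  ⊎ Swap (d 𝟏 (toℕ (punchIn i j))) (d 𝟏 k) (d 𝟏 (toℕ i)) (d 𝟏 (toℕ j)))
move-over-down zero    j       = 0 , inj₂ (swap¹¹ ℕ.z≤n)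
move-over-down (suc i) zero    = toℕ i , inj₁ (swap¹¹ ℕ.z≤n)
move-over-down (suc i) (suc j) with move-over-down i j
... | k , r = suc k , map-⊎ shift shift r
  where
  shift : ∀ {i j j′ k} → Swap (d 𝟏 i) (d 𝟏 j) (d 𝟏 j′) (d 𝟏 k) →
          Swap (d 𝟏 (suc i)) (d 𝟏 (suc j)) (d 𝟏 (suc j′)) (d 𝟏 (suc k))
  shift (swap¹¹ i≤j) = swap¹¹ (ℕ.s≤s i≤j)

data Entry (Act : Set) : Set where
  _⁺  : Act → Entry Act
  _^_ : Act → ℕ → Entry Act

module _ {X : HDA Act} where

  -- `start α j` is the value of "start" for a down-step d¹ⱼ directly after α.
  -- Once this step has moved over the last step of α, it directly follows the
  -- remaining prefix, which the replacement leaves unchanged.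
  start : ∀ {x} → PathTo X x → Fin (cellDim X x) → ℕ
  start (α ▸ up i refl) j with i ≟ j
  ... | yes _   = suc (length α)
  ... | no  i≢j = start α (punchOut i≢j)
  start (α ▸ down i refl) j = start α (punchIn i j)

  ST : ∀ {x} → PathTo X x → List (Entry Act)
  ST []                     = List.[]
  ST (α ▸ up   {V = V} i _) = ST α ∷ʳ (lookup V i ⁺)
  ST (α ▸ down {V = V} i _) = ST α ∷ʳ (lookup V i ^ start α i)

------------------------------------------------------------------------
-- I-bisimulations

data Clause : Set where
  ⊑ ⊒ ⇆ ↩ : Clause

Transfers : {Y Z : HDA Act} → (∀ {X : HDA Act} → Rel (Path X) 0ℓ) →
            REL (Path Y) (Path Z) 0ℓ → Set
Transfers _∼_ R = ∀ {α α′ β} → R α β → α ∼ α′ → ∃[ β′ ] (β ∼ β′ × R α′ β′)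

record IsSimulation (I : Pred Clause 0ℓ) {Y Z : HDA Act}
                    (R : REL (Path Y) (Path Z) 0ℓ) : Set where
  field
    empty  : R emptyPath emptyPath
    trace  : ∀ {α β} → R α β → ST (proj₂ α) ≡ ST (proj₂ β)
    extend : Transfers _↪_ R
    ⊑-clause : ⊑ ∈ I → ∀ ℓ → Transfers (λ α α′ → α ⊑⟨ ℓ ⟩ α′) R
    ⊒-clause : ⊒ ∈ I → ∀ ℓ → Transfers (λ α α′ → α′ ⊑⟨ ℓ ⟩ α) R
    ⇆-clause : ⇆ ∈ I → ∀ ℓ → Transfers (λ α α′ → α′ ⇆⟨ ℓ ⟩ α) R
    ↩-clause : ↩ ∈ I → Transfers (λ α α′ → α′ ↪ α) R

record IsBisimulation (I : Pred Clause 0ℓ) {Y Z : HDA Act}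
                      (R : REL (Path Y) (Path Z) 0ℓ) : Set where
  field
    forth : IsSimulation I R
    back  : IsSimulation I (flip R)

_↔[_]_ : HDA Act → Pred Clause 0ℓ → HDA Act → Set₁
Y ↔[ I ] Z = ∃ λ (R : REL (Path Y) (Path Z) 0ℓ) → IsBisimulation I R

reST : Pred Clause 0ℓ
reST = ｛ ⇆ ｝ ∪ ｛ ↩ ｝

ureST : Pred Clause 0ℓ
ureST = ｛ ⊒ ｝ ∪ ｛ ⇆ ｝ ∪ ｛ ↩ ｝

{-# OPTIONS --safe #-}
module Submission where

-- X k consists of faces of the 4-cube with events a, b, c, d.  Once a has ended there
-- are two branches, tagged true and false, each containing a square b × c; on branch
-- true, d may follow c if b has not started.  Finally, the square a × b is attached
-- to the b-edge of branch k.
--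
-- X true and X false are reST-bisimilar: paths are matched with the same tags if a has
-- ended before b starts and with opposite tags otherwise.  In the second case d never
-- becomes possible, and swaps do not reorder the end of a and the start of b.
--
-- A serialisation does reorder them.  It turns a⁺b⁺a into a⁺ab⁺ with the same end, on
-- branch true in X true and on branch false in X false.  Extending by c⁺, swapping b⁺
-- with c⁺ and removing b⁺ gives a⁺ac⁺ on that branch, and only branch true then has d.

open import Defs
open import Data.Bool using (Bool; true; false; not; _xor_; _∨_)
import Data.Bool.Properties as Bool
open import Data.Empty using (⊥)
open import Data.Fin using (Fin; zero; suc; _≤_; punchIn; punchOut)
open import Data.Fin.Properties
  using (any?; _≟_; ≤-antisym; punchOut-injective; punchOut-mono-≤; punchIn-punchOut)
open import Data.List using (List; []; _∷_; _∷ʳ_)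
open import Data.List.Membership.Propositional using (_∈_)
open import Data.List.Membership.Propositional.Properties using (∈-++⁺ˡ; ∈-++⁺ʳ; ∈-++⁻)
open import Data.List.Relation.Unary.Any using (here; there)
open import Data.List.Relation.Unary.Unique.Propositional using (Unique; []; _∷_)
open import Data.Nat using (ℕ; suc; z≤n; s≤s)
open import Data.Product using (∃; ∃₂; ∃-syntax; _×_; _,_; proj₁; proj₂)
open import Data.Sum using (_⊎_; inj₁; inj₂) renaming (map to map-⊎)
open import Data.Vec as Vec using (Vec; []; _∷_; lookup)
import Data.Vec.Relation.Unary.All.Properties as All
open import Data.Vec.Relation.Unary.Unique.Propositional
  using ([]; _∷_) renaming (Unique to UniqueVec)
open import Data.Vec.Relation.Unary.Unique.Propositional.Properties using (lookup-injective)
open import Function using (_∘_; id; Injective; mk⇔; Equivalence)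
open import Level using (0ℓ)
open import Relation.Binary using (_Preserves_⟶_; Rel; REL)
open import Relation.Binary.PropositionalEquality
open import Relation.Nullary
  using (¬_; Dec; yes; no; contradiction; recompute; decidable-stable; _×-dec_)
open import Relation.Unary using (Pred; _⊆_)

-- Faces of a cube as normal forms of morphisms.

module _ {Act : Set} where

  private variable
    m n p : ℕ
    U V W Γ : Vec Act n

  infixr 9 _⊙_

  -- A normal form for `Hom` up to `≈`: each position of the larger conclist is kept or fixed to a
  -- sign. Equivalent morphisms thus become equal terms.
  data Face : Vec Act m → Vec Act n → Set where
    []   : Face [] []
    keep : ∀ {x} {U : Vec Act m} {V : Vec Act n} → Face U V → Face (x ∷ U) (x ∷ V)
    fix  : ∀ {x} {U : Vec Act m} {V : Vec Act n} → Sign → Face U V → Face U (x ∷ V)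

  identity : Face U U
  identity {U = []}    = []
  identity {U = _ ∷ _} = keep identity

  _⊙_ : Face V W → Face U V → Face U W
  []      ⊙ []      = []
  keep F  ⊙ keep G  = keep (F ⊙ G)
  keep F  ⊙ fix s G = fix s (F ⊙ G)
  fix s F ⊙ G       = fix s (F ⊙ G)

  ⊙-identityʳ : (F : Face U V) → F ⊙ identity ≡ F
  ⊙-identityʳ []        = refl
  ⊙-identityʳ (keep F)  = cong keep (⊙-identityʳ F)
  ⊙-identityʳ (fix s F) = cong (fix s) (⊙-identityʳ F)

  ⊙-assoc : (F : Face W Γ) (G : Face V W) (H : Face U V) → (F ⊙ G) ⊙ H ≡ F ⊙ (G ⊙ H)
  ⊙-assoc []        []        []        = refl
  ⊙-assoc (keep F)  (keep G)  (keep H)  = cong keep (⊙-assoc F G H)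
  ⊙-assoc (keep F)  (keep G)  (fix s H) = cong (fix s) (⊙-assoc F G H)
  ⊙-assoc (keep F)  (fix s G) H         = cong (fix s) (⊙-assoc F G H)
  ⊙-assoc (fix s F) G         H         = cong (fix s) (⊙-assoc F G H)

  position : {U : Vec Act m} {V : Vec Act n} → Face U V → Fin m → Fin n
  position (keep F)  zero    = zero
  position (keep F)  (suc t) = suc (position F t)
  position (fix s F) t       = suc (position F t)

  value : {U : Vec Act m} {V : Vec Act n} → Face U V → Fin n → Value
  value (keep F)  zero    = ✶
  value (keep F)  (suc u) = value F u
  value (fix s F) zero    = sign s
  value (fix s F) (suc u) = value F u

  -- The values decide between `keep` and `fix` at every position. The laws of `toFace` below are
  -- therefore checked one value at a time.
  value-injective : (F G : Face U V) → (∀ u → value F u ≡ value G u) → F ≡ G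
  value-injective []        []        eq = refl
  value-injective (keep F)  (keep G)  eq = cong keep (value-injective F G (eq ∘ suc))
  value-injective (keep F)  (fix _ G) eq = contradiction (eq zero) λ ()
  value-injective (fix _ F) (keep G)  eq = contradiction (eq zero) λ ()
  value-injective (fix _ F) (fix _ G) eq with refl ← eq zero =
    cong (fix _) (value-injective F G (eq ∘ suc))

  value-position : (F : Face U V) → ∀ t → value F (position F t) ≡ ✶
  value-position (keep F)  zero    = refl
  value-position (keep F)  (suc t) = value-position F t
  value-position (fix s F) t       = value-position F t

  position-surjective : (F : Face U V) → ∀ u → value F u ≡ ✶ → ∃[ t ] position F t ≡ u
  position-surjective (keep F)  zero    eq = zero , refl
  position-surjective (keep F)  (suc u) eq
    with t , refl ← position-surjective F u eq = suc t , refl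
  position-surjective (fix s F) (suc u) eq
    with t , refl ← position-surjective F u eq = t , refl

  lookup-position : (F : Face U V) → ∀ t → lookup V (position F t) ≡ lookup U t
  lookup-position (keep F)  zero    = refl
  lookup-position (keep F)  (suc t) = lookup-position F t
  lookup-position (fix s F) t       = lookup-position F t

  value-⊙-position : (F : Face V W) (G : Face U V) → ∀ t →
                     value (F ⊙ G) (position F t) ≡ value G t
  value-⊙-position (keep F)  (keep G)  zero    = refl
  value-⊙-position (keep F)  (fix s G) zero    = refl
  value-⊙-position (keep F)  (keep G)  (suc t) = value-⊙-position F G t
  value-⊙-position (keep F)  (fix s G) (suc t) = value-⊙-position F G t
  value-⊙-position (fix s F) G         t       = value-⊙-position F G t

  value-⊙-sign : (F : Face V W) (G : Face U V) → ∀ {u s} →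
                 value F u ≡ sign s → value (F ⊙ G) u ≡ sign s
  value-⊙-sign (keep F)  (keep G)  {suc u} eq = value-⊙-sign F G eq
  value-⊙-sign (keep F)  (fix _ G) {suc u} eq = value-⊙-sign F G eq
  value-⊙-sign (fix _ F) G         {zero}  eq = eq
  value-⊙-sign (fix _ F) G         {suc u} eq = value-⊙-sign F G eq

  -- Translating morphisms into faces.

  module _ {x} {U : Vec Act m} {U′ : Vec Act p} {V : Vec Act n}
           (h : Hom (m , U) (suc n , x ∷ V)) (ι : Fin p → Fin m)
           (ι-injective : Injective _≡_ _≡_ ι) (ι-monotone : ι Preserves _≤_ ⟶ _≤_)
           (ι-labels : ∀ t → lookup U (ι t) ≡ lookup U′ t)
           (ι-nonzero : ∀ t → zero ≢ Hom.f h (ι t))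
           (ι-surjective : ∀ t → zero ≢ Hom.f h t → ∃[ s ] ι s ≡ t) where
    private
      module h = Hom h

      f′ : Fin p → Fin n
      f′ t = punchOut (ι-nonzero t)

      suc-f′ : ∀ t → suc (f′ t) ≡ h.f (ι t)
      suc-f′ t = punchIn-punchOut (ι-nonzero t)

    -- Removes position `zero` from the codomain. `ι` selects the events not sent there: all of them
    -- if `zero` is fixed, all but the first if it is kept.
    restrict : Hom (p , U′) (n , V)
    restrict = record
      { f         = f′
      ; ε         = h.ε ∘ suc
      ; injective = λ {s} {t} eq → ι-injective (h.injective
          (punchOut-injective (ι-nonzero s) (ι-nonzero t) eq))
      ; monotone  = λ {s} {t} s≤t →
          punchOut-mono-≤ (ι-nonzero s) (ι-nonzero t) (h.monotone (ι-monotone s≤t))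
      ; labels    = λ t → trans (cong (lookup (x ∷ V)) (suc-f′ t))
                                (trans (h.labels (ι t)) (ι-labels t))
      ; image     = λ u → mk⇔ (to u)
          (λ { (t , refl) → Equivalence.from (h.image (suc u)) (ι t , sym (suc-f′ t)) })
      }
      where
      to : ∀ u → h.ε (suc u) ≡ ✶ → ∃[ t ] f′ t ≡ u
      to u eq with t , ft≡ ← Equivalence.to (h.image (suc u)) eq
        with s , refl ← ι-surjective t (λ 0≡ → contradiction (trans 0≡ ft≡) λ ())
        with refl ← trans (suc-f′ s) ft≡ = s , refl

  module _ {x s} {U : Vec Act m} {V : Vec Act n}
           (h : Hom (m , U) (suc n , x ∷ V)) (eq : Hom.ε h zero ≡ sign s) where
    private
      module h = Hom h

      nonzero : ∀ t → zero ≢ h.f t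
      nonzero t 0≡ft = contradiction
        (trans (sym eq) (Equivalence.from (h.image zero) (t , sym 0≡ft))) λ ()

    tail-sign : Hom (m , U) (n , V)
    tail-sign = restrict h id id id (λ _ → refl) nonzero λ t _ → t , refl

    suc-tail-sign : ∀ t → suc (Hom.f tail-sign t) ≡ h.f t
    suc-tail-sign t = punchIn-punchOut (nonzero t)

  module _ {x y} {U : Vec Act m} {V : Vec Act n}
           (h : Hom (suc m , x ∷ U) (suc n , y ∷ V)) (eq : Hom.ε h zero ≡ ✶) where
    private module h = Hom h

    -- Some event is sent to `zero`, and by monotonicity the image of the first event is no larger.
    f-zero : h.f zero ≡ zero
    f-zero with t , ft≡0 ← Equivalence.to (h.image zero) eq =
      ≤-antisym (subst (h.f zero ≤_) ft≡0 (h.monotone z≤n)) z≤n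

    head-label : x ≡ y
    head-label = trans (sym (h.labels zero)) (cong (lookup (y ∷ V)) f-zero)

    private
      nonzero : ∀ t → zero ≢ h.f (suc t)
      nonzero t 0≡ft = contradiction (h.injective (trans f-zero 0≡ft)) λ ()

    tail-✶ : Hom (m , U) (n , V)
    tail-✶ = restrict h suc (λ { refl → refl }) s≤s (λ _ → refl) nonzero
      λ { zero 0≢ → contradiction (sym f-zero) 0≢ ; (suc t) _ → t , refl }

    suc-tail-✶ : ∀ t → suc (Hom.f tail-✶ t) ≡ h.f (suc t)
    suc-tail-✶ t = punchIn-punchOut (nonzero t)

  mutual
    toFace : ∀ (U : Vec Act m) (V : Vec Act n) → Hom (m , U) (n , V) → Face U V
    toFace U       (_ ∷ V) h = toFace-∷ U V h refl
    toFace []      []      h = []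
    toFace (_ ∷ _) []      h = contradiction (Hom.f h zero) λ ()

    -- The value at `zero` is a separate argument with an equation, so that the lemmas about
    -- `toFace` can split on it while `h` stays intact.
    toFace-∷ : ∀ {x v} (U : Vec Act m) (V : Vec Act n) (h : Hom (m , U) (suc n , x ∷ V)) →
               Hom.ε h zero ≡ v → Face U (x ∷ V)
    toFace-∷ {v = sign s} U V h eq = fix s (toFace U V (tail-sign h eq))
    toFace-∷ {v = ✶} [] V h eq =
      contradiction (proj₁ (Equivalence.to (Hom.image h zero) eq)) λ ()
    toFace-∷ {v = ✶} (_ ∷ U) V h eq with refl ← head-label h eq =
      keep (toFace U V (tail-✶ h eq))

  mutual
    value-toFace : ∀ (U : Vec Act m) (V : Vec Act n) (h : Hom (m , U) (n , V)) →
                   ∀ u → value (toFace U V h) u ≡ Hom.ε h u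
    value-toFace U (_ ∷ V) h = value-toFace-∷ U V h refl

    value-toFace-∷ : ∀ {x v} (U : Vec Act m) (V : Vec Act n)
                     (h : Hom (m , U) (suc n , x ∷ V)) (eq : Hom.ε h zero ≡ v) →
                     ∀ u → value (toFace-∷ U V h eq) u ≡ Hom.ε h u
    value-toFace-∷ {v = sign s} U V h eq zero    = sym eq
    value-toFace-∷ {v = sign s} U V h eq (suc u) = value-toFace U V (tail-sign h eq) u
    value-toFace-∷ {v = ✶} [] V h eq u =
      contradiction (proj₁ (Equivalence.to (Hom.image h zero) eq)) λ ()
    value-toFace-∷ {v = ✶} (_ ∷ U) V h eq u with refl ← head-label h eq with u
    ... | zero  = sym eq
    ... | suc u = value-toFace U V (tail-✶ h eq) u

  mutual
    position-toFace : ∀ (U : Vec Act m) (V : Vec Act n) (h : Hom (m , U) (n , V)) →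
                      ∀ t → position (toFace U V h) t ≡ Hom.f h t
    position-toFace U       (_ ∷ V) h   = position-toFace-∷ U V h refl
    position-toFace (_ ∷ _) []      h t = contradiction (Hom.f h zero) λ ()

    position-toFace-∷ : ∀ {x v} (U : Vec Act m) (V : Vec Act n)
                        (h : Hom (m , U) (suc n , x ∷ V)) (eq : Hom.ε h zero ≡ v) →
                        ∀ t → position (toFace-∷ U V h eq) t ≡ Hom.f h t
    position-toFace-∷ {v = sign s} U V h eq t =
      trans (cong suc (position-toFace U V (tail-sign h eq) t)) (suc-tail-sign h eq t)
    position-toFace-∷ {v = ✶} (_ ∷ U) V h eq t with refl ← head-label h eq with t
    ... | zero  = sym (f-zero h eq)
    ... | suc t =
      trans (cong suc (position-toFace U V (tail-✶ h eq) t)) (suc-tail-✶ h eq t)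

  toFace-≈ : {g h : Hom (m , U) (n , V)} → g ≈ h → toFace U V g ≡ toFace U V h
  toFace-≈ {U = U} {V = V} {g} {h} (_ , ε≗) = value-injective _ _ λ u →
    trans (value-toFace U V g u) (trans (ε≗ u) (sym (value-toFace U V h u)))

  value-identity : ∀ (U : Vec Act n) u → value (identity {U = U}) u ≡ ✶
  value-identity (_ ∷ _) zero    = refl
  value-identity (_ ∷ U) (suc u) = value-identity U u

  toFace-idHom : toFace U U (idHom (_ , U)) ≡ identity
  toFace-idHom {U = U} = value-injective _ _ λ u →
    trans (value-toFace U U (idHom _) u) (sym (value-identity U u))

  -- On the image of `h` both sides show the value of `k`; elsewhere both show a sign fixed by `h`.
  toFace-compHom : (h : Hom (m , V) (n , W)) (k : Hom (p , U) (m , V)) →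
                   toFace U W (compHom h k) ≡ toFace V W h ⊙ toFace U V k
  toFace-compHom {V = V} {W = W} {U = U} h k = value-injective _ _ λ u →
    trans (value-toFace U W (compHom h k) u) (compε-value u)
    where
    module h = Hom h
    module k = Hom k
    F = toFace V W h
    G = toFace U V k

    compε-value : ∀ u → compε h k u ≡ value (F ⊙ G) u
    compε-value u with any? (λ t → h.f t ≟ u)
    ... | yes (t , refl) = begin
      k.ε t                       ≡⟨ value-toFace U V k t ⟨
      value G t                   ≡⟨ value-⊙-position F G t ⟨
      value (F ⊙ G) (position F t) ≡⟨ cong (value (F ⊙ G)) (position-toFace V W h t) ⟩
      value (F ⊙ G) (h.f t)       ∎
      where open ≡-Reasoning
    ... | no t∄ with h.ε u in eq
    ...   | ✶      = contradiction (Equivalence.to (h.image u) eq) t∄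
    ...   | sign s = sym (value-⊙-sign F G (trans (value-toFace V W h u) eq))

  boundary : Sign → (i : Fin (suc n)) → Face (Vec.removeAt V i) V
  boundary s i = toFace _ _ (coface s i)

  -- A coface fixes one running event, and `position F i` is the place of that event in the ambient
  -- cube.
  value-⊙-boundary : (F : Face V Γ) (s : Sign) (i : Fin (suc n)) → ∀ u →
    value (F ⊙ boundary s i) u ≡ value F u ⊎
    value (F ⊙ boundary s i) u ≡ sign s × position F i ≡ u
  value-⊙-boundary {V = V} F s i u with value F u in eq
  ... | sign _ = inj₁ (value-⊙-sign F _ eq)
  ... | ✶ with t , refl ← position-surjective F u eq = map-⊎
    (trans value-t)
    (λ (eq , i≡t) → trans value-t eq , cong (position F) i≡t)
    (cofaceε-cases t)
    where
    value-t : value (F ⊙ boundary s i) (position F t) ≡ cofaceε s i t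
    value-t = trans (value-⊙-position F (boundary s i) t)
                    (value-toFace _ V (coface s i) t)

    cofaceε-cases : ∀ t → cofaceε s i t ≡ ✶ ⊎ cofaceε s i t ≡ sign s × i ≡ t
    cofaceε-cases t with i ≟ t
    ... | yes i≡t = inj₂ (refl , i≡t)
    ... | no  _   = inj₁ refl

-- Event values and tag normalisation.

pattern 𝟬 = sign 𝟎
pattern 𝟭 = sign 𝟏

A B C D : Fin 4
A = zero
B = suc zero
C = suc (suc zero)
D = suc (suc (suc zero))

started : Value → Bool
started 𝟬 = false
started 𝟭 = true
started ✶ = true

unstarted : ∀ {v} → started v ≡ false → v ≡ 𝟬
unstarted {𝟬} _ = refl

started-true : ∀ {v} → v ≢ 𝟬 → started v ≡ true
started-true {𝟬} v≢𝟬 = contradiction refl v≢𝟬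
started-true {𝟭} _   = refl
started-true {✶} _   = refl

_≟𝟬 : ∀ v → Dec (v ≡ 𝟬)
𝟬 ≟𝟬 = yes refl
𝟭 ≟𝟬 = no λ ()
✶ ≟𝟬 = no λ ()

_≟𝟭 : ∀ v → Dec (v ≡ 𝟭)
𝟬 ≟𝟭 = no λ ()
𝟭 ≟𝟭 = yes refl
✶ ≟𝟭 = no λ ()

-- Before branching, the tag carries no information and is reset to `true`, so that both branches
-- share these cells.
normalise : (branched tag : Bool) → Bool
normalise branched tag = not branched ∨ tag

-- `β` and `β′` stand for a cell and its face. A face is branched only if the cell is, so the
-- intermediate reset loses nothing.
normalise-normalise : ∀ β β′ t → (β′ ≡ true → β ≡ true) →
                      normalise β′ (normalise β t) ≡ normalise β′ t
normalise-normalise true  β′    t _ = refl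
normalise-normalise false false t _ = refl
normalise-normalise false true  t h = contradiction (h refl) λ ()

normalise-xor : ∀ μ β β′ t → (β′ ≡ true → β ≡ true) →
                normalise β′ (normalise β (μ xor t)) ≡ normalise β′ (μ xor normalise β′ t)
normalise-xor μ β false t h = refl
normalise-xor μ β true  t h rewrite h refl = refl

normalise-xor-involutive : ∀ μ β t → normalise β t ≡ t →
                           normalise β (μ xor normalise β (μ xor t)) ≡ t
normalise-xor-involutive μ     false t     eq = eq
normalise-xor-involutive false true  t     eq = refl
normalise-xor-involutive true  true  t     eq = Bool.not-involutive t

unique-fromList : ∀ {Act : Set} {xs : List Act} → Unique xs → UniqueVec (Vec.fromList xs)
unique-fromList []         = []
unique-fromList (x∉xs ∷ u) = All.fromList⁺ x∉xs ∷ unique-fromList u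

⁺-injective : ∀ {Act : Set} {x y : Act} → _≡_ {A = Entry Act} (x ⁺) (y ⁺) → x ≡ y
⁺-injective refl = refl

-- Replacements and simulations in general.

direction : Symbol → Sign
direction (Symbol.d s _) = s

-- All four steps are starts or all four are ends. This holds for swaps but not for serialisations,
-- and the transfer of replacements in `sim-replace` relies on it.
Parallel : Replacement → Set
Parallel T = ∀ {s t s′ t′} → T s t s′ t′ →
  direction t ≡ direction s × direction s′ ≡ direction s × direction t′ ≡ direction s

parallel-swap : Parallel Swap
parallel-swap (swap⁰⁰ _) = refl , refl , refl
parallel-swap (swap¹¹ _) = refl , refl , refl

converse : Replacement → Replacement
converse T s t s′ t′ = T s′ t′ s t

parallel-converse : ∀ {T} → Parallel T → Parallel (converse T)
parallel-converse T∥ t =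
  let q , p , r = T∥ t in trans r (sym p) , sym p , trans q (sym p)

module _ {Act : Set} {X : HDA Act} where

  replace-converse : ∀ {T ℓ} {α β : Path X} → Replace T ℓ α β → Replace (converse T) ℓ β α
  replace-converse (here t)  = here t
  replace-converse (there ρ) = there (replace-converse ρ)

  replace-end : ∀ {T ℓ} {α β : Path X} → Replace T ℓ α β → proj₁ α ≡ proj₁ β
  replace-end (here _)  = refl
  replace-end (there _) = refl

  swap-end : ∀ {ℓ} {α β : Path X} → β ⇆⟨ ℓ ⟩ α → proj₁ α ≡ proj₁ β
  swap-end (inj₁ ρ) = sym (replace-end ρ)
  swap-end (inj₂ ρ) = replace-end ρ

simulation-mono : ∀ {Act : Set} {I J : Pred Clause 0ℓ} {Y Z : HDA Act}
                    {R : REL (Path Y) (Path Z) 0ℓ} →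
                  J ⊆ I → IsSimulation I R → IsSimulation J R
simulation-mono J⊆I sim = record
  { empty    = empty
  ; trace    = trace
  ; extend   = extend
  ; ⊑-clause = ⊑-clause ∘ J⊆I
  ; ⊒-clause = ⊒-clause ∘ J⊆I
  ; ⇆-clause = ⇆-clause ∘ J⊆I
  ; ↩-clause = ↩-clause ∘ J⊆I
  }
  where open IsSimulation sim

module _ {Act : Set} {Y Z : HDA Act} {R S : REL (Path Y) (Path Z) 0ℓ}
         (R⇒S : ∀ {α β} → R α β → S α β) (S⇒R : ∀ {α β} → S α β → R α β) where

  transfers-resp : ∀ {_∼_ : ∀ {X : HDA Act} → Rel (Path X) 0ℓ} →
                   Transfers _∼_ R → Transfers _∼_ S
  transfers-resp transfer s α∼α′ with β′ , β∼β′ , r ← transfer (S⇒R s) α∼α′ =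
    β′ , β∼β′ , R⇒S r

  -- Serves the `back` direction: a simulation with the roles exchanged becomes one for `flip`, to
  -- which it is equivalent by symmetry.
  simulation-resp : ∀ {I} → IsSimulation I R → IsSimulation I S
  simulation-resp sim = record
    { empty    = R⇒S empty
    ; trace    = λ s → trace (S⇒R s)
    ; extend   = transfers-resp {_↪_} extend
    ; ⊑-clause = λ i ℓ → transfers-resp {λ α α′ → α ⊑⟨ ℓ ⟩ α′} (⊑-clause i ℓ)
    ; ⊒-clause = λ i ℓ → transfers-resp {λ α α′ → α′ ⊑⟨ ℓ ⟩ α} (⊒-clause i ℓ)
    ; ⇆-clause = λ i ℓ → transfers-resp {λ α α′ → α′ ⇆⟨ ℓ ⟩ α} (⇆-clause i ℓ)
    ; ↩-clause = λ i → transfers-resp {λ α α′ → α′ ↪ α} (↩-clause i)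
    }
    where open IsSimulation sim

-- The HDAs `X true` and `X false`.

module Example {Act : Set} (a b c d : Act) where

  Γ : Vec Act 4
  Γ = a ∷ b ∷ c ∷ d ∷ []

  private variable
    n : ℕ
    U V : Vec Act n

  branched : Face U Γ → Bool
  branched F = started (value F B) ∨ started (value F C)

  unbranched : (F : Face U Γ) → value F B ≡ 𝟬 → value F C ≡ 𝟬 → branched F ≡ false
  unbranched F B≡𝟬 C≡𝟬 = cong₂ (λ v w → started v ∨ started w) B≡𝟬 C≡𝟬

  branched-B : (F : Face U Γ) → value F B ≢ 𝟬 → branched F ≡ true
  branched-B F B≢𝟬 = cong (_∨ started (value F C)) (started-true B≢𝟬)

  branched-C : (F : Face U Γ) → value F C ≢ 𝟬 → branched F ≡ true
  branched-C F C≢𝟬 = trans (cong (started (value F B) ∨_) (started-true C≢𝟬))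
                           (Bool.∨-zeroʳ (started (value F B)))

  branched-⊙ : (F : Face V Γ) (G : Face U V) → branched (F ⊙ G) ≡ true → branched F ≡ true
  branched-⊙ F G eq with started (value F B) in eqB | started (value F C) in eqC
  ... | true  | _     = refl
  ... | false | true  = refl
  ... | false | false = trans (sym (unbranched (F ⊙ G)
    (value-⊙-sign F G (unstarted eqB)) (value-⊙-sign F G (unstarted eqC)))) eq

  -- The cell with events F on branch tag exists in X k.  The tag of a cell without
  -- b and c is irrelevant and canonically true.
  record Allowed (k : Bool) (F : Face U Γ) (tag : Bool) : Set where
    field
      canonical : normalise (branched F) tag ≡ tag
      b-allowed : value F B ≢ 𝟬 → value F A ≢ 𝟭 → tag ≡ k
      c-allowed : value F C ≢ 𝟬 → value F A ≡ 𝟭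
      d-allowed : value F D ≢ 𝟬 → value F A ≡ 𝟭 × value F B ≡ 𝟬 × tag ≡ true

  open Allowed

  -- Fixed values persist in faces. So an event not at `𝟬` in the face is not at `𝟬` in the cell,
  -- and the signs that the conditions require pass from the cell to the face.
  restrict-allowed : ∀ {k tag} (F : Face V Γ) (G : Face U V) → Allowed k F tag →
                     Allowed k (F ⊙ G) (normalise (branched (F ⊙ G)) tag)
  restrict-allowed F G ok = record
    { canonical = let β = branched (F ⊙ G) in normalise-normalise β β _ id
    ; b-allowed = λ B≢𝟬 A≢𝟭 → trans (cong (λ β → normalise β _) (branched-B (F ⊙ G) B≢𝟬))
        (b-allowed ok (B≢𝟬 ∘ value-⊙-sign F G) (A≢𝟭 ∘ value-⊙-sign F G))
    ; c-allowed = λ C≢𝟬 → value-⊙-sign F G (c-allowed ok (C≢𝟬 ∘ value-⊙-sign F G))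
    ; d-allowed = λ D≢𝟬 →
        let A≡𝟭 , B≡𝟬 , tag≡true = d-allowed ok (D≢𝟬 ∘ value-⊙-sign F G)
        in value-⊙-sign F G A≡𝟭 , value-⊙-sign F G B≡𝟬 ,
           trans (cong (not (branched (F ⊙ G)) ∨_) tag≡true)
                 (Bool.∨-zeroʳ (not (branched (F ⊙ G))))
    }

  -- Irrelevance of `allowed` lets face and tag alone determine a state. Decidable consequences are
  -- regained with `recompute`.
  record State (k : Bool) (U : Conclist Act) : Set where
    no-eta-equality
    pattern
    constructor state
    field
      face     : Face (proj₂ U) Γ
      tag      : Bool
      .allowed : Allowed k face tag

  open State

  state-≡ : ∀ {k U} {x y : State k U} → face x ≡ face y → tag x ≡ tag y → x ≡ y
  state-≡ {x = state _ _ _} {y = state _ _ _} refl refl = refl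

  tag-canonical : ∀ {k U} (x : State k U) → normalise (branched (face x)) (tag x) ≡ tag x
  tag-canonical (state _ _ ok) = recompute (_ Bool.≟ _) (canonical ok)

  states : Bool → PrecubicalSet Act
  states k = record
    { _[_]   = State k
    ; map    = map
    ; map-≈  = λ { {g = g} {h} g≈h (state F t _) →
        let eq = cong (F ⊙_) (toFace-≈ {g = g} {h} g≈h) in state-≡ eq (restrict-tag t eq) }
    ; map-id = λ { x@(state F t _) →
        let eq = trans (cong (F ⊙_) toFace-idHom) (⊙-identityʳ F)
        in state-≡ eq (trans (restrict-tag t eq) (tag-canonical x)) }
    ; map-∘  = λ { {U} {V} {W} h l (state F t _) →
        let H  = toFace (proj₂ V) (proj₂ W) h
            L  = toFace (proj₂ U) (proj₂ V) l
            eq = trans (cong (F ⊙_) (toFace-compHom h l)) (sym (⊙-assoc F H L))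
        in state-≡ eq (trans (restrict-tag t eq)
             (sym (normalise-normalise _ _ t (branched-⊙ (F ⊙ H) L)))) }
    }
    where
    map : ∀ {U V} → Hom U V → State k V → State k U
    map {U} {V} h (state F t ok) = state (F ⊙ H) _ (restrict-allowed F H ok)
      where H = toFace (proj₂ U) (proj₂ V) h

    restrict-tag : ∀ t {F G : Face U Γ} → F ≡ G →
                   normalise (branched F) t ≡ normalise (branched G) t
    restrict-tag t = cong λ F → normalise (branched F) t

  X : Bool → HDA Act
  X k = record
    { precubicalSet = states k
    ; init          = state (fix 𝟎 (fix 𝟎 (fix 𝟎 (fix 𝟎 [])))) true record
        { canonical = refl
        ; b-allowed = contradiction refl
        ; c-allowed = contradiction refl
        ; d-allowed = contradiction refl
        }
    }

  private variable
    k k′ μ μ′ : Bool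
    W : Conclist Act

  -- Events along a step; past and fresh cells.

  step-unstarted : ∀ {x y} e → Step (X k) x y →
                   value (face (proj₂ y)) e ≡ 𝟬 → value (face (proj₂ x)) e ≡ 𝟬
  step-unstarted e (up {x = state F _ _} i refl) eq = value-⊙-sign F (boundary 𝟎 i) eq
  step-unstarted e (down {x = state F _ _} i refl) eq with value-⊙-boundary F 𝟏 i e
  ... | inj₁ p       = trans (sym p) eq
  ... | inj₂ (p , _) = contradiction (trans (sym p) eq) λ ()

  step-ended : ∀ {x y} e → Step (X k) x y →
               value (face (proj₂ x)) e ≡ 𝟭 → value (face (proj₂ y)) e ≡ 𝟭
  step-ended e (up {x = state F _ _} i refl) eq with value-⊙-boundary F 𝟎 i e
  ... | inj₁ p       = trans (sym p) eq
  ... | inj₂ (p , _) = contradiction (trans (sym p) eq) λ ()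
  step-ended e (down {x = state F _ _} i refl) eq = value-⊙-sign F (boundary 𝟏 i) eq

  tag-b : (x : State k W) → value (face x) B ≢ 𝟬 → value (face x) A ≢ 𝟭 → tag x ≡ k
  tag-b (state _ _ ok) B≢𝟬 A≢𝟭 = recompute (_ Bool.≟ _) (b-allowed ok B≢𝟬 A≢𝟭)

  tag-d : (x : State k W) → value (face x) D ≢ 𝟬 → tag x ≡ true
  tag-d (state _ _ ok) D≢𝟬 = recompute (_ Bool.≟ _) (proj₂ (proj₂ (d-allowed ok D≢𝟬)))

  -- Every cell in which `d` has started is of this kind, so tags must not be exchanged here.
  Past : State k W → Set
  Past x = value (face x) A ≡ 𝟭 × value (face x) B ≡ 𝟬

  Fresh : State k W → Set
  Fresh x = value (face x) A ≢ 𝟭 × value (face x) B ≡ 𝟬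

  past-δ : ∀ {V : Vec Act (suc n)} s i (x : State k (_ , V)) → Past x → Past (HDA.δ (X k) s i x)
  past-δ s i (state F _ _) (A≡𝟭 , B≡𝟬) =
    value-⊙-sign F (boundary s i) A≡𝟭 , value-⊙-sign F (boundary s i) B≡𝟬

  step-fresh : ∀ {x y} → Step (X k) x y → Fresh (proj₂ y) → Fresh (proj₂ x)
  step-fresh φ (A≢𝟭 , B≡𝟬) = A≢𝟭 ∘ step-ended A φ , step-unstarted B φ B≡𝟬

  -- `c` requires the end of `a`, so neither `b` nor `c` has started.
  fresh-unbranched : (x : State k W) → Fresh x → branched (face x) ≡ false
  fresh-unbranched (state F _ ok) (A≢𝟭 , B≡𝟬) =
    unbranched F B≡𝟬 (recompute (_ ≟𝟬) (C≡𝟬 ok))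
    where
    C≡𝟬 : ∀ {k t} → Allowed k F t → value F C ≡ 𝟬
    C≡𝟬 ok with value F C ≟𝟬
    ... | yes eq = eq
    ... | no neq = contradiction (c-allowed ok neq) A≢𝟭

  -- Matching cells and paths in mode `μ`.

  record Match (μ : Bool) {k k′ U} (x : State k U) (y : State k′ U) : Set where
    constructor match
    field
      same-face : face x ≡ face y
      same-tag  : tag y ≡ normalise (branched (face x)) (μ xor tag x)
      not-past  : μ ≡ true → ¬ Past x

  open Match

  match-sym : {x : State k W} {y : State k′ W} → Match μ x y → Match μ y x
  match-sym {μ = μ} {x = x@(state F t _)} {y = state .F _ _} (match refl refl ¬past) =
    match refl (sym (normalise-xor-involutive μ (branched F) t (tag-canonical x))) ¬past

  match-unique : {x : State k W} {y z : State k′ W} → Match μ x y → Match μ x z → y ≡ z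
  match-unique r s = state-≡ (trans (sym (same-face r)) (same-face s))
                             (trans (same-tag r) (sym (same-tag s)))

  -- The tag may be reset before or after the exchange by `μ`. The condition on the face is there
  -- because ending `a` can lead into a past cell.
  match-δ : ∀ {V : Vec Act (suc n)} {x : State k (_ , V)} {y : State k′ (_ , V)} s i →
            (μ ≡ true → ¬ Past (HDA.δ (X k) s i x)) → Match μ x y →
            Match μ (HDA.δ (X k) s i x) (HDA.δ (X k′) s i y)
  match-δ {μ = μ} {x = state F t _} {y = state .F _ _} s i ¬past (match refl refl _) =
    match refl (normalise-xor μ (branched F) _ t (branched-⊙ F (boundary s i))) ¬past

  match-fresh : {x : State k W} {y : State k′ W} → Fresh x → Match μ x y → Match μ′ x y
  match-fresh {x = x} {y} fresh r = match (same-face r)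
    (trans (same-tag r) (unbranched-tag (fresh-unbranched x fresh)))
    λ _ (A≡𝟭 , _) → proj₁ fresh A≡𝟭
    where
    unbranched-tag : ∀ {β t u} → β ≡ false → normalise β t ≡ normalise β u
    unbranched-tag refl = refl

  -- Only `b-allowed` refers to `k`, so it is the one condition to be supplied anew.
  keep-allowed : ∀ {F : Face U Γ} {t} → (value F B ≢ 𝟬 → value F A ≢ 𝟭 → t ≡ k′) →
                 Allowed k F t → Allowed k′ F (normalise (branched F) t)
  keep-allowed {F = F} {t} b-ok ok = subst (Allowed _ F) (sym (canonical ok)) record
    { canonical = canonical ok
    ; b-allowed = b-ok
    ; c-allowed = c-allowed ok
    ; d-allowed = d-allowed ok
    }

  -- Where `b` ties the tag to `k`, the exchanged tag is `not k`. The condition on `d` is void,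
  -- since `d` has started only in past cells.
  flip-allowed : ∀ {F : Face U Γ} {t} → ¬ (value F A ≡ 𝟭 × value F B ≡ 𝟬) →
                 Allowed k F t → Allowed (not k) F (normalise (branched F) (not t))
  flip-allowed {F = F} {t} ¬past ok = record
    { canonical = normalise-normalise (branched F) _ (not t) id
    ; b-allowed = λ B≢𝟬 A≢𝟭 → trans (cong (λ β → normalise β (not t)) (branched-B F B≢𝟬))
                                    (cong not (b-allowed ok B≢𝟬 A≢𝟭))
    ; c-allowed = c-allowed ok
    ; d-allowed = λ D≢𝟬 → let A≡𝟭 , B≡𝟬 , _ = d-allowed ok D≢𝟬
                          in contradiction (A≡𝟭 , B≡𝟬) ¬past
    }

  mate-keep : (x : State k W) → (value (face x) B ≢ 𝟬 → value (face x) A ≡ 𝟭) →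
              ∃ {A = State k′ W} (Match false x)
  mate-keep (state F t ok) b-ok =
    state F _ (keep-allowed (λ B≢𝟬 A≢𝟭 → contradiction (b-ok B≢𝟬) A≢𝟭) ok) ,
    match refl refl λ ()

  mate-flip : k ≢ k′ → (x : State k W) → ¬ Past x → ∃ {A = State k′ W} (Match true x)
  mate-flip k≢k′ (state F t ok) ¬past with refl ← Bool.¬-not (k≢k′ ∘ sym) =
    state F _ (flip-allowed ¬past ok) , match refl refl λ _ → ¬past

  -- Related paths carry the same tags in mode μ = false and opposite tags in mode
  -- μ = true.  A cell without events on a branch has no opposite tag, so the mode can
  -- still change on fresh cells; in past cells the mode must be false, because d
  -- exists only on branch true.
  data Sim (μ : Bool) {k k′} : ∀ {W} {x : State k W} {y : State k′ W} →
           PathTo (X k) (W , x) → PathTo (X k′) (W , y) → Set where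
    []   : Sim μ [] []
    up   : ∀ {W} {x : State k W} {y : State k′ W} {α β} {V : Vec Act (suc n)}
           {x′ : State k (_ , V)} {y′ : State k′ (_ , V)} i
           {p : (W , x) ≡ (_ , HDA.δ (X k) 𝟎 i x′)} {q : (W , y) ≡ (_ , HDA.δ (X k′) 𝟎 i y′)} →
           Sim μ α β → Match μ x′ y′ → Sim μ (α ▸ up i p) (β ▸ up i q)
    down : ∀ {W} {x : State k W} {y : State k′ W} {V : Vec Act (suc n)}
           {x′ : State k (_ , V)} {y′ : State k′ (_ , V)} {α β} i
           {p : (W , x) ≡ (_ , HDA.δ (X k) 𝟏 i x′)} {q : (W , y) ≡ (_ , HDA.δ (X k′) 𝟏 i y′)} →
           Sim μ α β → Match μ x y → Sim μ (α ▸ down i p) (β ▸ down i q)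

  sim-match : ∀ {x : State k W} {y : State k′ W}
                {α : PathTo (X k) (W , x)} {β : PathTo (X k′) (W , y)} →
              Sim μ α β → Match μ x y
  sim-match []           = match refl refl λ _ (A≡𝟭 , _) → contradiction A≡𝟭 λ ()
  sim-match (up _ _ r)   = r
  sim-match (down _ _ r) = r

  sim-sym : ∀ {x : State k W} {y : State k′ W}
              {α : PathTo (X k) (W , x)} {β : PathTo (X k′) (W , y)} →
            Sim μ α β → Sim μ β α
  sim-sym []           = []
  sim-sym (up i s r)   = up i (sim-sym s) (match-sym r)
  sim-sym (down i s r) = down i (sim-sym s) (match-sym r)

  -- Fresh cells have only fresh predecessors, and a match between them does not depend on the mode,
  -- so the mode can be replaced along the whole path.
  sim-fresh : ∀ {x : State k W} {y : State k′ W}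
                {α : PathTo (X k) (W , x)} {β : PathTo (X k′) (W , y)} →
              Fresh x → Sim μ α β → Sim μ′ α β
  sim-fresh f []               = []
  sim-fresh f (up i {p} s r)   = up i (sim-fresh (step-fresh (up i p) f) s) (match-fresh f r)
  sim-fresh f (down i {p} s r) = down i (sim-fresh (step-fresh (down i p) f) s) (match-fresh f r)

  sim-length : ∀ {x : State k W} {y : State k′ W}
                 {α : PathTo (X k) (W , x)} {β : PathTo (X k′) (W , y)} →
               Sim μ α β → length α ≡ length β
  sim-length []           = refl
  sim-length (up _ s _)   = cong suc (sim-length s)
  sim-length (down _ s _) = cong suc (sim-length s)

  sim-start : ∀ {x : State k W} {y : State k′ W}
                {α : PathTo (X k) (W , x)} {β : PathTo (X k′) (W , y)} →
              Sim μ α β → ∀ j → start α j ≡ start β j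
  sim-start (up i {refl} {refl} s r) j with i ≟ j
  ... | yes _   = cong suc (sim-length s)
  ... | no  i≢j = sim-start s (punchOut i≢j)
  sim-start (down i {refl} {refl} s r) j = sim-start s (punchIn i j)

  sim-ST : ∀ {x : State k W} {y : State k′ W}
             {α : PathTo (X k) (W , x)} {β : PathTo (X k′) (W , y)} →
           Sim μ α β → ST α ≡ ST β
  sim-ST []                   = refl
  sim-ST (up {V = V} i s _)   = cong (_∷ʳ (lookup V i ⁺)) (sim-ST s)
  sim-ST (down {V = V} i s _) =
    cong₂ (λ τ n → τ ∷ʳ (lookup V i ^ n)) (sim-ST s) (sim-start s i)

  -- Faces of matching cells match and mates are unique, so `β` ends where the up-step into `y`
  -- begins.
  sim-δ : ∀ {V : Vec Act (suc n)} {x : State k (_ , V)} {y : State k′ (_ , V)} i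
          {z : State k′ (_ , Vec.removeAt V i)} {α β} →
          Sim μ {x = HDA.δ (X k) 𝟎 i x} {z} α β → Match μ x y →
          _≡_ {A = HDA.Cell (X k′)} (_ , z) (_ , HDA.δ (X k′) 𝟎 i y)
  sim-δ i s r =
    cong (_ ,_) (match-unique (sim-match s) (match-δ 𝟎 i (not-past (sim-match s)) r))

  past? : (x : State k W) → Dec (Past x)
  past? x = (value (face x) A ≟𝟭) ×-dec (value (face x) B ≟𝟬)

  -- If `b` had started while `a` has not ended, the tags would be `k` and `k′`, but mode `false`
  -- makes them equal.
  keep-fresh : {x : State k W} {y : State k′ W} → k ≢ k′ → Match false x y →
               value (face x) A ≢ 𝟭 → Fresh x
  keep-fresh {x = x@(state F t _)} {y = y@(state .F _ _)} k≢k′ (match refl refl _) A≢𝟭 =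
    A≢𝟭 , decidable-stable (_ ≟𝟬) λ B≢𝟬 → k≢k′
      (trans (sym (tag-b x B≢𝟬 A≢𝟭)) (trans (sym (tag-canonical x)) (tag-b y B≢𝟬 A≢𝟭)))

  module _ {k k′ : Bool} (k≢k′ : k ≢ k′) where

    extend-step : ∀ {x′} {x : State k W} {y : State k′ W} {α β} → Sim μ {x = x} {y} α β →
                  (φ : Step (X k) (W , x) x′) →
                  ∃₂ λ μ′ (y′ : State k′ (proj₁ x′)) → ∃ λ (ψ : Step (X k′) (W , y) (_ , y′)) →
                  Sim μ′ (α ▸ φ) (β ▸ ψ)
    -- A past target would have a past source, which mode `true` excludes.
    extend-step {μ = true} s (up {x = x′} i refl)
      with y′ , r ← mate-flip k≢k′ x′ (not-past (sim-match s) refl ∘ past-δ 𝟎 i x′) =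
      _ , y′ , up i (sim-δ i s r) , up i s r
    extend-step {μ = false} s φ@(up {x = x′} i refl)
      with value (face x′) A ≟𝟭
    ... | yes A≡𝟭 with y′ , r ← mate-keep x′ (λ _ → A≡𝟭) =
      _ , y′ , up i (sim-δ i s r) , up i s r
    -- The source is fresh, so its mode may switch to `true`; if `b` starts now, the tags become `k`
    -- and `k′`.
    ... | no A≢𝟭
      with s′ ← sim-fresh (keep-fresh k≢k′ (sim-match s) (A≢𝟭 ∘ step-ended A φ)) s
         | y′ , r ← mate-flip k≢k′ x′ (A≢𝟭 ∘ proj₁) =
      _ , y′ , up i (sim-δ i s′ r) , up i s′ r
    extend-step {μ = false} s (down i refl) =
      _ , _ , down i refl , down i s (match-δ 𝟏 i (λ ()) (sim-match s))
    extend-step {μ = true} s φ@(down {x = x} i refl) with past? (HDA.δ (X k) 𝟏 i x)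
    ... | no ¬past = _ , _ , down i refl , down i s (match-δ 𝟏 i (λ _ → ¬past) (sim-match s))
    -- The step ends `a` from a fresh cell, where the mode may switch to `false` before the past
    -- cell is entered.
    ... | yes (_ , B≡𝟬)
      with B≡𝟬′ ← step-unstarted B φ B≡𝟬
      with A≢𝟭 ← (λ A≡𝟭 → not-past (sim-match s) refl (A≡𝟭 , B≡𝟬′))
      with s′ ← sim-fresh {μ′ = false} (A≢𝟭 , B≡𝟬′) s =
      _ , _ , down i refl , down i s′ (match-δ 𝟏 i (λ ()) (sim-match s′))

  -- The ends of the replaced segment stay, so only the new middle cell needs a match. In mode
  -- `true` it is not past: otherwise the source would be past for two starts, or the target for two
  -- ends. A serialisation can put a past cell between two that are not.
  sim-replace : ∀ {T ℓ} {x : State k W} {y : State k′ W} {α α′ : PathTo (X k) (W , x)}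
                {β : PathTo (X k′) (W , y)} → Parallel T → Sim μ α β →
                Replace T ℓ (_ , α) (_ , α′) →
                ∃[ β′ ] (Replace T ℓ (_ , β) (_ , β′) × Sim μ α′ β′)
  sim-replace T∥ (up i s r) (there ρ) with _ , ρ′ , s′ ← sim-replace T∥ s ρ =
    _ , there ρ′ , up i s′ r
  sim-replace T∥ (down i s r) (there ρ) with _ , ρ′ , s′ ← sim-replace T∥ s ρ =
    _ , there ρ′ , down i s′ r
  sim-replace T∥ (up _ (up _ s _) r) (here {φ′ = up i refl} {ψ′ = up {x = z} j refl} t)
    rewrite sim-length s
    with r′ ← match-δ 𝟎 j (λ μ≡ → not-past (sim-match s) μ≡ ∘ past-δ 𝟎 i (HDA.δ (X _) 𝟎 j z)) r =
    _ , here {φ′ = up i (sim-δ i s r′)} {ψ′ = up j refl} t , up j (up i s r′) r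
  sim-replace T∥ (down _ (down _ s _) r) (here {φ′ = down {x = x} i refl} {ψ′ = down j refl} t)
    rewrite sim-length s
    with r′ ← match-δ 𝟏 i (λ μ≡ → not-past r μ≡ ∘ past-δ 𝟏 j (HDA.δ (X _) 𝟏 i x)) (sim-match s)
    with z≡ ← match-unique r (match-δ 𝟏 j (not-past r) r′) =
    _ , here {φ′ = down i refl} {ψ′ = down j (cong (_ ,_) z≡)} t , down j (down i s r′) r
  sim-replace T∥ (up _ (down _ _ _) _) (here t) = contradiction (proj₁ (T∥ t)) λ ()
  sim-replace T∥ (down _ (up _ _ _) _) (here t) = contradiction (proj₁ (T∥ t)) λ ()
  sim-replace T∥ (up _ (up _ _ _) _) (here {φ′ = down _ _} t) =
    contradiction (proj₁ (proj₂ (T∥ t))) λ ()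
  sim-replace T∥ (up _ (up _ _ _) _) (here {φ′ = up _ _} {ψ′ = down _ _} t) =
    contradiction (proj₂ (proj₂ (T∥ t))) λ ()
  sim-replace T∥ (down _ (down _ _ _) _) (here {φ′ = up _ _} t) =
    contradiction (proj₁ (proj₂ (T∥ t))) λ ()
  sim-replace T∥ (down _ (down _ _ _) _) (here {φ′ = down _ _} {ψ′ = up _ _} t) =
    contradiction (proj₂ (proj₂ (T∥ t))) λ ()

  -- The reST-bisimulation.

  data Related {k k′} : REL (Path (X k)) (Path (X k′)) 0ℓ where
    related : ∀ {W} {x : State k W} {y : State k′ W} {α β} →
              Sim μ {x = x} {y} α β → Related (_ , α) (_ , β)

  related-sym : ∀ {α : Path (X k)} {β : Path (X k′)} → Related α β → Related β α
  related-sym (related s) = related (sim-sym s)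

  related-replace : ∀ {T ℓ} {α α′ : Path (X k)} {β : Path (X k′)} → Parallel T →
                    Related α β → Replace T ℓ α α′ →
                    ∃[ β′ ] (Replace T ℓ β β′ × Related α′ β′)
  related-replace T∥ (related s) ρ with refl ← replace-end ρ
    with _ , ρ′ , s′ ← sim-replace T∥ s ρ = _ , ρ′ , related s′

  related-⇆ : ∀ ℓ → Transfers (λ α α′ → α′ ⇆⟨ ℓ ⟩ α) (Related {k} {k′})
  related-⇆ ℓ r (inj₁ ρ)
    with _ , ρ′ , r′ ← related-replace {T = converse Swap}
      (parallel-converse {T = Swap} parallel-swap) r (replace-converse ρ) =
    _ , inj₁ (replace-converse {T = converse Swap} ρ′) , r′
  related-⇆ ℓ r (inj₂ ρ) with _ , ρ′ , r′ ← related-replace parallel-swap r ρ =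
    _ , inj₂ ρ′ , r′

  related-↪ : k ≢ k′ → Transfers _↪_ (Related {k} {k′})
  related-↪ k≢k′ r ↪-refl = _ , ↪-refl , r
  related-↪ k≢k′ r (↪-step {φ = φ} α↪α′) with _ , β↪β′ , related s ← related-↪ k≢k′ r α↪α′
    with _ , _ , _ , s′ ← extend-step k≢k′ s φ = _ , ↪-step β↪β′ , related s′

  related-↩ : Transfers (λ α α′ → α′ ↪ α) (Related {k} {k′})
  related-↩ r ↪-refl = _ , ↪-refl , r
  related-↩ (related (up _ s _)) (↪-step α′↪α) with _ , β′↪β , r ← related-↩ (related s) α′↪α =
    _ , ↪-step β′↪β , r
  related-↩ (related (down _ s _)) (↪-step α′↪α) with _ , β′↪β , r ← related-↩ (related s) α′↪α =
    _ , ↪-step β′↪β , r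

  related-simulation : k ≢ k′ → IsSimulation reST (Related {k} {k′})
  related-simulation k≢k′ = record
    { empty    = related {μ = false} []
    ; trace    = λ { (related s) → sim-ST s }
    ; extend   = related-↪ k≢k′
    ; ⊑-clause = λ { (inj₁ ()) ; (inj₂ ()) }
    ; ⊒-clause = λ { (inj₁ ()) ; (inj₂ ()) }
    ; ⇆-clause = λ _ → related-⇆
    ; ↩-clause = λ _ → related-↩
    }

  X-reST : X true ↔[ reST ] X false
  X-reST = Related , record
    { forth = related-simulation λ ()
    ; back  = simulation-resp related-sym related-sym (related-simulation λ ())
    }

  -- Branches along paths and the failure of ureST-bisimilarity.

  step-branched : ∀ {x y} → Step (X k) x y →
                  branched (face (proj₂ x)) ≡ true → branched (face (proj₂ y)) ≡ true
  step-branched {x = _ , x} {_ , y} φ eq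
    with value (face y) B ≟𝟬 | value (face y) C ≟𝟬
  ... | no B≢𝟬  | _       = branched-B (face y) B≢𝟬
  ... | yes _   | no C≢𝟬  = branched-C (face y) C≢𝟬
  ... | yes B≡𝟬 | yes C≡𝟬 = contradiction
    (trans (sym eq) (unbranched (face x) (step-unstarted B φ B≡𝟬) (step-unstarted C φ C≡𝟬))) λ ()

  -- `normalise` leaves the tag of a branched cell alone, and no step undoes branching.
  step-tag : ∀ {x y} (φ : Step (X k) x y) →
             branched (face (proj₂ x)) ≡ true → tag (proj₂ y) ≡ tag (proj₂ x)
  step-tag (up {x = state _ t _} i refl) eq = cong (λ β → normalise β t) (sym eq)
  step-tag φ@(down {x = state F t _} i refl) eq =
    cong (λ β → normalise β t) (step-branched φ eq)

  OnBranch : Bool → HDA.Cell (X k) → Set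
  OnBranch t (_ , x) = branched (face x) ≡ true × tag x ≡ t

  ↪-branch : ∀ {t} {α β : Path (X k)} → α ↪ β → OnBranch t (proj₁ α) → OnBranch t (proj₁ β)
  ↪-branch ↪-refl br = br
  ↪-branch (↪-step {φ = φ} α↪β) br with eq , tag≡ ← ↪-branch α↪β br =
    step-branched φ eq , trans (step-tag φ eq) tag≡

  -- Used contrapositively: a trace without an end of `a` shows that `a` has not ended in the last
  -- cell.
  ended-∈-ST : ∀ {x} (α : PathTo (X k) x) e → value (face (proj₂ x)) e ≡ 𝟭 →
               ∃[ n ] (lookup Γ e ^ n) ∈ ST α
  ended-∈-ST [] zero                   ()
  ended-∈-ST [] (suc zero)             ()
  ended-∈-ST [] (suc (suc zero))       ()
  ended-∈-ST [] (suc (suc (suc zero))) ()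
  ended-∈-ST (α ▸ up {x = state F _ _} i refl) e eq
    with n , ∈α ← ended-∈-ST α e (value-⊙-sign F (boundary 𝟎 i) eq) = n , ∈-++⁺ˡ ∈α
  ended-∈-ST (α ▸ down {x = state F _ _} i refl) e eq with value-⊙-boundary F 𝟏 i e
  ... | inj₁ p with n , ∈α ← ended-∈-ST α e (trans (sym p) eq) = n , ∈-++⁺ˡ ∈α
  ... | inj₂ (_ , refl) =
    start α i , ∈-++⁺ʳ (ST α) (here (cong (_^ start α i) (lookup-position F i)))

  module _ (distinct : Unique (a ∷ b ∷ c ∷ d ∷ [])) where

    -- An entry records only a label; distinctness of the labels recovers the event from it.
    started-∈-ST : ∀ {x} (α : PathTo (X k) x) e → (lookup Γ e ⁺) ∈ ST α →
                   value (face (proj₂ x)) e ≢ 𝟬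
    started-∈-ST (α ▸ φ@(up {x = state F _ _} i _)) e ∈α with ∈-++⁻ (ST α) ∈α
    ... | inj₁ ∈α′ = started-∈-ST α e ∈α′ ∘ step-unstarted e φ
    ... | inj₂ (here eq)
      with refl ← lookup-injective (unique-fromList distinct) e (position F i)
        (trans (⁺-injective eq) (sym (lookup-position F i))) =
      λ e≡𝟬 → contradiction (trans (sym (value-position F i)) e≡𝟬) λ ()
    started-∈-ST (α ▸ φ@(down i _)) e ∈α with ∈-++⁻ (ST α) ∈α
    ... | inj₁ ∈α′       = started-∈-ST α e ∈α′ ∘ step-unstarted e φ
    ... | inj₂ (here ())

    private
      tagged : (F : Face U Γ) → (value F C ≢ 𝟬 → value F A ≡ 𝟭) →
               (value F D ≢ 𝟬 → value F A ≡ 𝟭 × value F B ≡ 𝟬) → State true (_ , U)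
      tagged F c-ok d-ok = state F true record
        { canonical = Bool.∨-zeroʳ (not (branched F))
        ; b-allowed = λ _ _ → refl
        ; c-allowed = c-ok
        ; d-allowed = λ D≢𝟬 → let A≡𝟭 , B≡𝟬 = d-ok D≢𝟬 in A≡𝟭 , B≡𝟬 , refl
        }

      -- The names of cells list the values of `a`, `b`, `c`, `d`; those of the paths below spell
      -- out their traces.
      ✶𝟬𝟬𝟬 = tagged (keep (fix 𝟎 (fix 𝟎 (fix 𝟎 [])))) (contradiction refl) (contradiction refl)
      ✶✶𝟬𝟬 = tagged (keep (keep (fix 𝟎 (fix 𝟎 [])))) (contradiction refl) (contradiction refl)
      𝟭✶𝟬𝟬 = tagged (fix 𝟏 (keep (fix 𝟎 (fix 𝟎 [])))) (contradiction refl) (contradiction refl)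
      𝟭𝟬✶𝟬 = tagged (fix 𝟏 (fix 𝟎 (keep (fix 𝟎 [])))) (λ _ → refl) (contradiction refl)
      𝟭✶✶𝟬 = tagged (fix 𝟏 (keep (keep (fix 𝟎 [])))) (λ _ → refl) (contradiction refl)
      𝟭𝟬𝟭✶ = tagged (fix 𝟏 (fix 𝟎 (fix 𝟏 (keep [])))) (λ _ → refl) (λ _ → refl , refl)

      a⁺ : PathTo (X true) (_ , ✶𝟬𝟬𝟬)
      a⁺ = [] ▸ up zero refl

      a⁺b⁺ : PathTo (X true) (_ , ✶✶𝟬𝟬)
      -- `b` is the second event running in `✶✶𝟬𝟬`; once `a` has ended, its index is `zero`.
      a⁺b⁺ = a⁺ ▸ up (suc zero) refl

      a⁺b⁺a : PathTo (X true) (_ , 𝟭✶𝟬𝟬)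
      a⁺b⁺a = a⁺b⁺ ▸ down zero refl

      a⁺a : PathTo (X true) (_ , HDA.δ (X true) 𝟏 zero ✶𝟬𝟬𝟬)
      a⁺a = a⁺ ▸ down zero refl

      a⁺ab⁺ : PathTo (X true) (_ , 𝟭✶𝟬𝟬)
      a⁺ab⁺ = a⁺a ▸ up zero refl

      a⁺ab⁺c⁺ : PathTo (X true) (_ , 𝟭✶✶𝟬)
      a⁺ab⁺c⁺ = a⁺ab⁺ ▸ up (suc zero) refl

      a⁺ac⁺ : PathTo (X true) (_ , 𝟭𝟬✶𝟬)
      a⁺ac⁺ = a⁺a ▸ up zero refl

      a⁺ac⁺b⁺ : PathTo (X true) (_ , 𝟭✶✶𝟬)
      a⁺ac⁺b⁺ = a⁺ac⁺ ▸ up zero refl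

      a⁺ac⁺cd⁺ : PathTo (X true) (_ , 𝟭𝟬𝟭✶)
      a⁺ac⁺cd⁺ = a⁺ac⁺ ▸ down zero refl ▸ up zero refl

    module _ {R : REL (Path (X true)) (Path (X false)) 0ℓ} (sim : IsSimulation ureST R) where
      open IsSimulation sim

      started-related : ∀ {α β} e → R α β → (lookup Γ e ⁺) ∈ ST (proj₂ α) →
                        value (face (proj₂ (proj₁ β))) e ≢ 𝟬
      started-related {β = _ , β} e r ∈α = started-∈-ST β e (subst (_ ∈_) (trace r) ∈α)

      -- After a⁺b⁺ the second path is on branch false, where it stays: replacements
      -- keep the end of the path, and the branch is constant once it is chosen.
      no-simulation : ⊥
      no-simulation
        with β₀ , _ , r₀ ← extend {α′ = _ , a⁺b⁺} empty (↪-step (↪-step ↪-refl))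
        with β₁ , β₀↪β₁ , r₁ ← extend {α′ = _ , a⁺b⁺a} r₀ (↪-step ↪-refl)
        -- The cell at position 2 is `✶✶𝟬𝟬`, where the index of `b` exceeds that of `a`; hence
        -- `serial>`.
        with β₂ , β₂⊑β₁ , r₂ ← ⊒-clause (inj₁ refl) 2 {α′ = _ , a⁺ab⁺} r₁ (here (serial> z≤n))
        with β₃ , β₂↪β₃ , r₃ ← extend {α′ = _ , a⁺ab⁺c⁺} r₂ (↪-step ↪-refl)
        -- With `c` started before `b`, the prefix taken next omits `b`, which leaves room for `d`.
        with β₄ , β₄⇆β₃ , r₄ ←
          ⇆-clause (inj₂ (inj₁ refl)) 3 {α′ = _ , a⁺ac⁺b⁺} r₃ (inj₂ (here (swap⁰⁰ z≤n)))
        with β₅ , β₅↪β₄ , r₅ ← ↩-clause (inj₂ (inj₂ refl)) {α′ = _ , a⁺ac⁺} r₄ (↪-step ↪-refl)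
        with β₆ , β₅↪β₆ , r₆ ← extend {α′ = _ , a⁺ac⁺cd⁺} r₅ (↪-step (↪-step ↪-refl)) =
        contradiction (trans (sym tag₆) (proj₂ branch₆)) λ ()
        where
        tag₆ : tag (proj₂ (proj₁ β₆)) ≡ true
        tag₆ = tag-d (proj₂ (proj₁ β₆))
          (started-related D r₆ (there (there (there (there (here refl))))))

        b₀ = started-related B r₀ (there (here refl))

        branch₀ : OnBranch false (proj₁ β₀)
        branch₀ = branched-B (face (proj₂ (proj₁ β₀))) b₀ , tag-b (proj₂ (proj₁ β₀)) b₀ λ A≡𝟭 →
          a-running (proj₂ (ended-∈-ST (proj₂ β₀) A A≡𝟭))
          where
          -- The common trace consists of two starts.
          a-running : ∀ {n} → ¬ (a ^ n) ∈ ST (proj₂ β₀)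
          a-running ∈β₀ with subst (_ ∈_) (sym (trace r₀)) ∈β₀
          ... | there (there ())

        branch₂ : OnBranch false (proj₁ β₂)
        branch₂ = subst (OnBranch false) (replace-end β₂⊑β₁) (↪-branch β₀↪β₁ branch₀)

        branch₄ : OnBranch false (proj₁ β₄)
        branch₄ = subst (OnBranch false) (swap-end β₄⇆β₃) (↪-branch β₂↪β₃ branch₂)

        branch₅ : OnBranch false (proj₁ β₅)
        -- `β₅` is a prefix of `β₄` in which `c` has started, so its tag is already final and equals
        -- that of `β₄`.
        branch₅ = br , trans (sym (proj₂ (↪-branch β₅↪β₄ (br , refl)))) (proj₂ branch₄)
          where
          br = branched-C (face (proj₂ (proj₁ β₅)))
            (started-related C r₅ (there (there (here refl))))

        branch₆ : OnBranch false (proj₁ β₆)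
        branch₆ = ↪-branch β₅↪β₆ branch₅

theorem5p14 : (Act : Set) (a b c d : Act) → Unique (a ∷ b ∷ c ∷ d ∷ []) →
    ((Y Z : HDA Act) → Y ↔[ ureST ] Z → Y ↔[ reST ] Z)
    × (∃₂ λ (Y Z : HDA Act) → (Y ↔[ reST ] Z) × ¬ (Y ↔[ ureST ] Z))
theorem5p14 Act a b c d′ distinct =
  -- The relation is unchanged; `inj₂` includes the clauses of `reST` in those of `ureST`.
  (λ { _ _ (R , bisim) → R , record
     { forth = simulation-mono inj₂ (forth bisim)
     ; back  = simulation-mono inj₂ (back bisim)
     } }) ,
  X true , X false , X-reST , λ (_ , bisim) → no-simulation distinct (forth bisim)
  where
  open Example a b c d′
  open IsBisimulation
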